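{- Let $t$ be a complex number. For any two sequences of complex numbers $\{a_n\}_{n\ge 1}$ and $\{b_n\}_{n\ge 1}$ the following two conditions are equivalent: $$a_n=n\sum_{m=1}^n\binom{mt}{n-m}b_m\quad\text{for all } n\ge 1$$ and $$b_n=\frac 1n\sum_{m=1}^{n}\binom{ -nt}{n-m}a_m\quad\text{for all } n\ge 1.$$
   Context: Binomial coefficients are generalized: for any complex number $z$ and integer $j\ge 0$, $\binom{z}{j}=\frac{z(z-1)\cdots(z-j+1)}{j!}$ (with $\binom z0=1$). -}

module Defs where

open import Algebra.Bundles using (CommutativeRing)
open import Algebra.Structures using (IsCommutativeRing)
open import Data.Fin.Base using (toℕ)
import Data.Integer.Base as ℤ
open import Data.Nat.Base as ℕ using (ℕ; zero; suc; NonZero; _!)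
import Data.Nat.Properties as ℕₚ
open import Data.Product.Base using (∃; _,_; _×_)
open import Data.Rational.Base as ℚ using (ℚ; 0ℚ; 1ℚ; ½)
import Data.Rational.Properties as ℚₚ
open import Data.Rational.Solver using (module +-*-Solver)
import Data.Rational.Unnormalised.Base as ℚᵘ
import Data.Rational.Unnormalised.Properties as ℚᵘₚ
open import Level using (Level; 0ℓ)
open import Relation.Binary.PropositionalEquality
  using (_≡_; refl; sym; cong; subst)

-- ℝ is the ring of Cauchy sequences of rationals; equality is the setoid
-- relation "the difference tends to zero".
module Real where

  open import Data.Rational.Base using (_<_; _≤_; _+_; _*_; _-_; -_; ∣_∣)

  -- u m n → 0 as m and n tend to infinity independently.
  Null : (ℕ → ℕ → ℚ) → Set
  Null u = ∀ ε → 0ℚ < ε →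
    ∃ λ N → ∀ m n → N ℕ.≤ m → N ℕ.≤ n → ∣ u m n ∣ < ε

  Cauchy : (ℕ → ℚ) → Set
  Cauchy x = Null λ m n → x m - x n

  record ℝ : Set where
    constructor mkℝ
    field
      seq    : ℕ → ℚ
      cauchy : Cauchy seq

  open ℝ public

  infix 4 _≈_

  -- Only one of the two indices of Null is used here. A record, unlike a
  -- function, lets Agda recover x and y from the type x ≈ y.
  record _≈_ (x y : ℝ) : Set where
    constructor mk≈
    field
      diff→0 : Null λ n _ → seq x n - seq y n

  open _≈_ public

  private
    variable
      u v : ℕ → ℕ → ℚ

    Bounded : (ℕ → ℕ → ℚ) → Set
    Bounded u = ∃ λ B → 0ℚ < B ×
      ∃ λ N → ∀ m n → N ℕ.≤ m → N ℕ.≤ n → ∣ u m n ∣ ≤ B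

    abstract

      null-resp : (∀ m n → u m n ≡ v m n) → Null u → Null v
      null-resp u≡v U ε ε>0 with N , h ← U ε ε>0 =
        N , λ m n p q → subst (λ z → ∣ z ∣ < ε) (u≡v m n) (h m n p q)

      null-0 : Null λ _ _ → 0ℚ
      null-0 ε ε>0 = 0 , λ _ _ _ _ → ε>0

      null-neg : Null u → Null λ m n → - u m n
      null-neg {u} U ε ε>0 with N , h ← U ε ε>0 =
        N , λ m n p q → subst (_< ε) (sym (ℚₚ.∣-p∣≡∣p∣ (u m n))) (h m n p q)

      half>0 : ∀ {ε} → 0ℚ < ε → 0ℚ < ε * ½
      half>0 = ℚₚ.*-monoˡ-<-pos ½

      half+half : ∀ ε → ε * ½ + ε * ½ ≡ ε
      half+half ε = begin
        ε * ½ + ε * ½  ≡⟨ ℚₚ.*-distribˡ-+ ε ½ ½ ⟨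
        ε * 1ℚ         ≡⟨ ℚₚ.*-identityʳ ε ⟩
        ε              ∎
        where open Relation.Binary.PropositionalEquality.≡-Reasoning

      null-+ : Null u → Null v → Null λ m n → u m n + v m n
      null-+ {u} {v} U V ε ε>0
        with M , g ← U (ε * ½) (half>0 ε>0)
           | N , h ← V (ε * ½) (half>0 ε>0) =
        M ℕ.⊔ N , λ m n p q → begin-strict
          ∣ u m n + v m n ∣      ≤⟨ ℚₚ.∣p+q∣≤∣p∣+∣q∣ (u m n) (v m n) ⟩
          ∣ u m n ∣ + ∣ v m n ∣  <⟨ ℚₚ.+-mono-<
            (g m n (ℕₚ.m⊔n≤o⇒m≤o M N p) (ℕₚ.m⊔n≤o⇒m≤o M N q))
            (h m n (ℕₚ.m⊔n≤o⇒n≤o M N p) (ℕₚ.m⊔n≤o⇒n≤o M N q)) ⟩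
          ε * ½ + ε * ½          ≡⟨ half+half ε ⟩
          ε                      ∎
        where open ℚₚ.≤-Reasoning

      null-* : Bounded u → Null v → Null λ m n → u m n * v m n
      null-* {u} {v} (B , B>0 , M , g) V ε ε>0 = bound (V (ε * B⁻¹) εB⁻¹>0)
        where
        instance
          B-pos : ℚ.Positive B
          B-pos = ℚ.positive B>0
          B≢0 : ℚ.NonZero B
          B≢0 = ℚₚ.pos⇒nonZero B
          B-nonNeg : ℚ.NonNegative B
          B-nonNeg = ℚₚ.pos⇒nonNeg B
        B⁻¹ : ℚ
        B⁻¹ = ℚ.1/ B
        instance
          B⁻¹-pos : ℚ.Positive B⁻¹
          B⁻¹-pos = ℚₚ.1/pos⇒pos B
        εB⁻¹>0 : 0ℚ < ε * B⁻¹
        εB⁻¹>0 = subst (_< ε * B⁻¹) (ℚₚ.*-zeroˡ B⁻¹) (ℚₚ.*-monoˡ-<-pos B⁻¹ ε>0)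
        open ℚₚ.≤-Reasoning
        B*εB⁻¹≡ε : B * (ε * B⁻¹) ≡ ε
        B*εB⁻¹≡ε = begin-equality
          B * (ε * B⁻¹)  ≡⟨ solve 3 (λ b e c → b :* (e :* c) := e :* (b :* c)) refl B ε B⁻¹ ⟩
          ε * (B * B⁻¹)  ≡⟨ cong (ε *_) (ℚₚ.*-inverseʳ B) ⟩
          ε * 1ℚ         ≡⟨ ℚₚ.*-identityʳ ε ⟩
          ε              ∎
          where open +-*-Solver
        bound : (∃ λ N → ∀ m n → N ℕ.≤ m → N ℕ.≤ n → ∣ v m n ∣ < ε * B⁻¹) →
                ∃ λ N → ∀ m n → N ℕ.≤ m → N ℕ.≤ n → ∣ u m n * v m n ∣ < ε
        bound (N , h) = M ℕ.⊔ N , λ m n p q → begin-strict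
          ∣ u m n * v m n ∣      ≡⟨ ℚₚ.∣p*q∣≡∣p∣*∣q∣ (u m n) (v m n) ⟩
          ∣ u m n ∣ * ∣ v m n ∣  ≤⟨ ℚₚ.*-monoʳ-≤-nonNeg ∣ v m n ∣ {{ℚ.nonNegative (ℚₚ.0≤∣p∣ (v m n))}}
            (g m n (ℕₚ.m⊔n≤o⇒m≤o M N p) (ℕₚ.m⊔n≤o⇒m≤o M N q)) ⟩
          B * ∣ v m n ∣          <⟨ ℚₚ.*-monoʳ-<-pos B
            (h m n (ℕₚ.m⊔n≤o⇒n≤o M N p) (ℕₚ.m⊔n≤o⇒n≤o M N q)) ⟩
          B * (ε * B⁻¹)          ≡⟨ B*εB⁻¹≡ε ⟩
          ε                      ∎

      bounded : (x : ℝ) → ∃ λ B → 0ℚ < B × ∃ λ N → ∀ n → N ℕ.≤ n → ∣ seq x n ∣ ≤ B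
      bounded x with N , h ← cauchy x 1ℚ (ℚₚ.positive⁻¹ 1ℚ) =
        1ℚ + ∣ seq x N ∣
        , ℚₚ.+-mono-<-≤ (ℚₚ.positive⁻¹ 1ℚ) (ℚₚ.0≤∣p∣ (seq x N))
        , N , λ n p → begin
          ∣ seq x n ∣
            ≡⟨ cong ∣_∣ (solve 2 (λ a b → a := (a :- b) :+ b) refl (seq x n) (seq x N)) ⟩
          ∣ (seq x n - seq x N) + seq x N ∣
            ≤⟨ ℚₚ.∣p+q∣≤∣p∣+∣q∣ (seq x n - seq x N) (seq x N) ⟩
          ∣ seq x n - seq x N ∣ + ∣ seq x N ∣
            ≤⟨ ℚₚ.+-monoˡ-≤ ∣ seq x N ∣ (ℚₚ.<⇒≤ (h n N p ℕₚ.≤-refl)) ⟩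
          1ℚ + ∣ seq x N ∣
            ∎
        where
        open ℚₚ.≤-Reasoning
        open +-*-Solver

    boundedˡ : (x : ℝ) → Bounded λ m _ → seq x m
    boundedˡ x = let B , B>0 , N , h = bounded x in B , B>0 , N , λ m _ p _ → h m p

    boundedʳ : (x : ℝ) → Bounded λ _ n → seq x n
    boundedʳ x = let B , B>0 , N , h = bounded x in B , B>0 , N , λ _ n _ q → h n q

    open +-*-Solver

    sum-diff : ∀ a b c d → (a - c) + (b - d) ≡ (a + b) - (c + d)
    sum-diff = solve 4 (λ a b c d → (a :- c) :+ (b :- d) := (a :+ b) :- (c :+ d)) refl

    neg-diff : ∀ a b → - (a - b) ≡ (- a) - (- b)
    neg-diff = solve 2 (λ a b → :- (a :- b) := (:- a) :- (:- b)) refl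

    product-diff : ∀ a b c d → a * (b - d) + d * (a - c) ≡ a * b - c * d
    product-diff = solve 4
      (λ a b c d → a :* (b :- d) :+ d :* (a :- c) := a :* b :- c :* d) refl

  ≡⇒≈ : ∀ {x y} → (∀ n → seq x n ≡ seq y n) → x ≈ y
  ≡⇒≈ {x} {y} x≡y = mk≈ (null-resp
    (λ n _ → sym (subst (λ z → z - seq y n ≡ 0ℚ) (sym (x≡y n)) (ℚₚ.+-inverseʳ (seq y n))))
    null-0)

  -- Opaque because unfolding rational arithmetic during conversion checking is
  -- prohibitively slow.
  opaque

    fromℚ : ℚ → ℝ
    fromℚ q = mkℝ (λ _ → q) (null-resp (λ _ _ → sym (ℚₚ.+-inverseʳ q)) null-0)

    addℝ mulℝ : ℝ → ℝ → ℝ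
    addℝ x y = mkℝ (λ n → seq x n + seq y n) (null-resp
      (λ m n → sum-diff (seq x m) (seq y m) (seq x n) (seq y n))
      (null-+ (cauchy x) (cauchy y)))
    mulℝ x y = mkℝ (λ n → seq x n * seq y n) (null-resp
      (λ m n → product-diff (seq x m) (seq y m) (seq x n) (seq y n))
      (null-+ (null-* (boundedˡ x) (cauchy y)) (null-* (boundedʳ y) (cauchy x))))

    negℝ : ℝ → ℝ
    negℝ x = mkℝ (λ n → - seq x n)
      (null-resp (λ m n → neg-diff (seq x m) (seq x n)) (null-neg (cauchy x)))

    ℝ-isCommutativeRing :
      IsCommutativeRing _≈_ addℝ mulℝ negℝ (fromℚ 0ℚ) (fromℚ 1ℚ)
    ℝ-isCommutativeRing = record
      { isRing = record
        { +-isAbelianGroup = record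
          { isGroup = record
            { isMonoid = record
              { isSemigroup = record
                { isMagma = record
                  { isEquivalence = record
                    { refl  = ≡⇒≈ λ _ → refl
                    ; sym   = λ {x} {y} p → mk≈ (null-resp
                        (λ n _ → solve 2 (λ a b → :- (a :- b) := b :- a) refl (seq x n) (seq y n))
                        (null-neg (diff→0 p)))
                    ; trans = λ {x} {y} {z} p q → mk≈ (null-resp
                        (λ n _ → solve 3 (λ a b c → (a :- b) :+ (b :- c) := a :- c) refl
                          (seq x n) (seq y n) (seq z n))
                        (null-+ (diff→0 p) (diff→0 q)))
                    }
                  ; ∙-cong = λ {x} {x′} {y} {y′} p q → mk≈ (null-resp
                      (λ n _ → sum-diff (seq x n) (seq y n) (seq x′ n) (seq y′ n))
                      (null-+ (diff→0 p) (diff→0 q)))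
                  }
                ; assoc = λ x y z → ≡⇒≈ λ n → ℚₚ.+-assoc (seq x n) (seq y n) (seq z n)
                }
              ; identity = (λ x → ≡⇒≈ λ n → ℚₚ.+-identityˡ (seq x n))
                         , (λ x → ≡⇒≈ λ n → ℚₚ.+-identityʳ (seq x n))
              }
            ; inverse = (λ x → ≡⇒≈ λ n → ℚₚ.+-inverseˡ (seq x n))
                      , (λ x → ≡⇒≈ λ n → ℚₚ.+-inverseʳ (seq x n))
            ; ⁻¹-cong = λ {x} {y} p → mk≈ (null-resp
                (λ n _ → neg-diff (seq x n) (seq y n)) (null-neg (diff→0 p)))
            }
          ; comm = λ x y → ≡⇒≈ λ n → ℚₚ.+-comm (seq x n) (seq y n)
          }
        ; *-cong = λ {x} {x′} {y} {y′} p q → mk≈ (null-resp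
            (λ n _ → product-diff (seq x n) (seq y n) (seq x′ n) (seq y′ n))
            (null-+ (null-* (boundedˡ x) (diff→0 q)) (null-* (boundedˡ y′) (diff→0 p))))
        ; *-assoc = λ x y z → ≡⇒≈ λ n → ℚₚ.*-assoc (seq x n) (seq y n) (seq z n)
        ; *-identity = (λ x → ≡⇒≈ λ n → ℚₚ.*-identityˡ (seq x n))
                     , (λ x → ≡⇒≈ λ n → ℚₚ.*-identityʳ (seq x n))
        ; distrib = (λ x y z → ≡⇒≈ λ n → ℚₚ.*-distribˡ-+ (seq x n) (seq y n) (seq z n))
                  , (λ x y z → ≡⇒≈ λ n → ℚₚ.*-distribʳ-+ (seq x n) (seq y n) (seq z n))
        }
      ; *-comm = λ x y → ≡⇒≈ λ n → ℚₚ.*-comm (seq x n) (seq y n)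
      }

    fromℚ-homo-+ : ∀ p q → fromℚ (p + q) ≈ addℝ (fromℚ p) (fromℚ q)
    fromℚ-homo-+ p q = ≡⇒≈ λ _ → refl

    fromℚ-homo-* : ∀ p q → fromℚ (p * q) ≈ mulℝ (fromℚ p) (fromℚ q)
    fromℚ-homo-* p q = ≡⇒≈ λ _ → refl

  ℝ-commutativeRing : CommutativeRing 0ℓ 0ℓ
  ℝ-commutativeRing = record
    { Carrier = ℝ
    ; _≈_ = _≈_
    ; _+_ = addℝ
    ; _*_ = mulℝ
    ; -_  = negℝ
    ; 0#  = fromℚ 0ℚ
    ; 1#  = fromℚ 1ℚ
    ; isCommutativeRing = ℝ-isCommutativeRing
    }

-- R[i] = R[x]/(x² + 1) for a commutative ring R.
module AdjoinI {c ℓ : Level} (R : CommutativeRing c ℓ) where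

  private
    module R = CommutativeRing R
    open R using (_+_; _*_; _-_; -_; 0#; 1#)
    open import Algebra.Properties.Ring R.ring using (-1*x≈-x)
    open import Algebra.Solver.Ring.NaturalCoefficients.Default R.commutativeSemiring
      using (solve; _:=_; _:+_; _:*_)

    -0≈0 : - 0# R.≈ 0#
    -0≈0 = R.trans (R.sym (R.+-identityˡ _)) (R.-‿inverseʳ 0#)

  infix 4 _≈_

  record R[i] : Set c where
    constructor mkR[i]
    field
      re im : R.Carrier

  open R[i] public

  record _≈_ (z w : R[i]) : Set ℓ where
    constructor mk≈
    field
      re≈ : re z R.≈ re w
      im≈ : im z R.≈ im w

  open _≈_ public

  addC mulC : R[i] → R[i] → R[i]
  addC z w = mkR[i] (re z + re w) (im z + im w)
  mulC z w = mkR[i] (re z * re w - im z * im w) (re z * im w + im z * re w)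

  negC : R[i] → R[i]
  negC z = mkR[i] (- re z) (- im z)

  ofR : R.Carrier → R[i]
  ofR x = mkR[i] x 0#

  R[i]-commutativeRing : CommutativeRing c ℓ
  R[i]-commutativeRing = record
    { Carrier = R[i]
    ; _≈_ = _≈_
    ; _+_ = addC
    ; _*_ = mulC
    ; -_  = negC
    ; 0#  = ofR 0#
    ; 1#  = ofR 1#
    ; isCommutativeRing = record
      { isRing = record
        { +-isAbelianGroup = record
          { isGroup = record
            { isMonoid = record
              { isSemigroup = record
                { isMagma = record
                  { isEquivalence = record
                    { refl  = mk≈ R.refl R.refl
                    ; sym   = λ p → mk≈ (R.sym (re≈ p)) (R.sym (im≈ p))
                    ; trans = λ p q → mk≈ (R.trans (re≈ p) (re≈ q)) (R.trans (im≈ p) (im≈ q))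
                    }
                  ; ∙-cong = λ p q → mk≈ (R.+-cong (re≈ p) (re≈ q)) (R.+-cong (im≈ p) (im≈ q))
                  }
                ; assoc = λ x y z → mk≈ (R.+-assoc _ _ _) (R.+-assoc _ _ _)
                }
              ; identity = (λ z → mk≈ (R.+-identityˡ _) (R.+-identityˡ _))
                         , (λ z → mk≈ (R.+-identityʳ _) (R.+-identityʳ _))
              }
            ; inverse = (λ z → mk≈ (R.-‿inverseˡ _) (R.-‿inverseˡ _))
                      , (λ z → mk≈ (R.-‿inverseʳ _) (R.-‿inverseʳ _))
            ; ⁻¹-cong = λ p → mk≈ (R.-‿cong (re≈ p)) (R.-‿cong (im≈ p))
            }
          ; comm = λ z w → mk≈ (R.+-comm _ _) (R.+-comm _ _)
          }
        ; *-cong = λ p q → mk≈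
            (R.+-cong (R.*-cong (re≈ p) (re≈ q)) (R.-‿cong (R.*-cong (im≈ p) (im≈ q))))
            (R.+-cong (R.*-cong (re≈ p) (im≈ q)) (R.*-cong (im≈ p) (re≈ q)))
        ; *-assoc = *-assoc
        ; *-identity = *-identityˡ
                     , λ z → trans (*-comm z (ofR 1#)) (*-identityˡ z)
        ; distrib = distribˡ
                  , λ x y z → trans (*-comm (addC y z) x) (trans (distribˡ x y z)
                      (mk≈ (R.+-cong (re≈ (*-comm x y)) (re≈ (*-comm x z)))
                           (R.+-cong (im≈ (*-comm x y)) (im≈ (*-comm x z)))))
        }
      ; *-comm = *-comm
      }
    }
    where
    trans : ∀ {x y z} → x ≈ y → y ≈ z → x ≈ z
    trans p q = mk≈ (R.trans (re≈ p) (re≈ q)) (R.trans (im≈ p) (im≈ q))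

    *-comm : ∀ z w → mulC z w ≈ mulC w z
    *-comm z w = mk≈
      (R.+-cong (R.*-comm _ _) (R.-‿cong (R.*-comm _ _)))
      (R.trans (R.+-comm _ _) (R.+-cong (R.*-comm _ _) (R.*-comm _ _)))

    *-identityˡ : ∀ z → mulC (ofR 1#) z ≈ z
    *-identityˡ z = mk≈
      (R.trans (R.+-cong (R.*-identityˡ _) (R.trans (R.-‿cong (R.zeroˡ _)) -0≈0)) (R.+-identityʳ _))
      (R.trans (R.+-cong (R.*-identityˡ _) (R.zeroˡ _)) (R.+-identityʳ _))

    -- With ν = −1 treated as a further variable, the remaining laws are
    -- identities of commutative semirings.
    ν : R.Carrier
    ν = - 1#

    ν* : ∀ x → - x R.≈ ν * x
    ν* x = R.sym (-1*x≈-x x)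

    diff : ∀ {x x′ y y′} → x R.≈ x′ → y R.≈ y′ → x - y R.≈ x′ + ν * y′
    diff p q = R.+-cong p (R.trans (ν* _) (R.*-congˡ q))

    *-assoc : ∀ x y z → mulC (mulC x y) z ≈ mulC x (mulC y z)
    *-assoc (mkR[i] a b) (mkR[i] c d) (mkR[i] e f) = mk≈
      (R.trans (diff (R.*-congʳ (diff R.refl R.refl)) R.refl) (R.trans
        (solve 7 (λ a b c d e f ν →
            (a :* c :+ ν :* (b :* d)) :* e :+ ν :* ((a :* d :+ b :* c) :* f)
          := a :* (c :* e :+ ν :* (d :* f)) :+ ν :* (b :* (c :* f :+ d :* e)))
          R.refl a b c d e f ν)
        (R.sym (diff (R.*-congˡ (diff R.refl R.refl)) R.refl))))
      (R.trans (R.+-congʳ (R.*-congʳ (diff R.refl R.refl))) (R.trans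
        (solve 7 (λ a b c d e f ν →
            (a :* c :+ ν :* (b :* d)) :* f :+ (a :* d :+ b :* c) :* e
          := a :* (c :* f :+ d :* e) :+ b :* (c :* e :+ ν :* (d :* f)))
          R.refl a b c d e f ν)
        (R.sym (R.+-congˡ (R.*-congˡ (diff R.refl R.refl))))))

    distribˡ : ∀ x y z → mulC x (addC y z) ≈ addC (mulC x y) (mulC x z)
    distribˡ (mkR[i] a b) (mkR[i] c d) (mkR[i] e f) = mk≈
      (R.trans (diff R.refl R.refl) (R.trans
        (solve 7 (λ a b c d e f ν →
            a :* (c :+ e) :+ ν :* (b :* (d :+ f))
          := (a :* c :+ ν :* (b :* d)) :+ (a :* e :+ ν :* (b :* f)))
          R.refl a b c d e f ν)
        (R.sym (R.+-cong (diff R.refl R.refl) (diff R.refl R.refl)))))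
      (solve 6 (λ a b c d e f →
          a :* (d :+ f) :+ b :* (c :+ e)
        := (a :* d :+ b :* c) :+ (a :* f :+ b :* e))
        R.refl a b c d e f)

  ofR-homo-+ : ∀ {z x y} → z R.≈ x + y → ofR z ≈ addC (ofR x) (ofR y)
  ofR-homo-+ z≈x+y = mk≈ z≈x+y (R.sym (R.+-identityʳ 0#))

  ofR-homo-* : ∀ {z x y} → z R.≈ x * y → ofR z ≈ mulC (ofR x) (ofR y)
  ofR-homo-* {z} {x} {y} z≈x*y = mk≈
    (R.trans z≈x*y (R.sym (R.trans
      (R.+-congˡ (R.trans (R.-‿cong (R.zeroˡ 0#)) -0≈0))
      (R.+-identityʳ _))))
    (R.sym (R.trans (R.+-cong (R.zeroʳ x) (R.zeroˡ y)) (R.+-identityʳ 0#)))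

private
  module C = AdjoinI Real.ℝ-commutativeRing
  module ≈ = CommutativeRing C.R[i]-commutativeRing

ℂ : Set
ℂ = C.R[i]

ℂ-commutativeRing : CommutativeRing 0ℓ 0ℓ
ℂ-commutativeRing = C.R[i]-commutativeRing

open CommutativeRing ℂ-commutativeRing public
  using (_≈_; _+_; _*_; _-_; -_; 0#; 1#)

fromℚ : ℚ → ℂ
fromℚ q = C.ofR (Real.fromℚ q)

fromℚ-homo-+ : ∀ p q → fromℚ (p ℚ.+ q) ≈ fromℚ p + fromℚ q
fromℚ-homo-+ p q =
  C.ofR-homo-+ {Real.fromℚ (p ℚ.+ q)} {Real.fromℚ p} {Real.fromℚ q} (Real.fromℚ-homo-+ p q)

fromℚ-homo-* : ∀ p q → fromℚ (p ℚ.* q) ≈ fromℚ p * fromℚ q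
fromℚ-homo-* p q =
  C.ofR-homo-* {Real.fromℚ (p ℚ.* q)} {Real.fromℚ p} {Real.fromℚ q} (Real.fromℚ-homo-* p q)

fromℕ : ℕ → ℂ
fromℕ n = fromℚ (ℤ.+ n ℚ./ 1)

1/ℕ : (n : ℕ) → .{{NonZero n}} → ℂ
1/ℕ n = fromℚ (ℤ.+ 1 ℚ./ n)

1/ℕ-inverseʳ : (n : ℕ) → .{{_ : NonZero n}} → fromℕ n * 1/ℕ n ≈ 1#
1/ℕ-inverseʳ n@(suc k) = ≈.trans (≈.sym (fromℚ-homo-* (ℤ.+ n ℚ./ 1) (ℤ.+ 1 ℚ./ n)))
  (≈.reflexive (cong fromℚ n*1/n≡1))
  where
  n*1/n≡1 : (ℤ.+ n ℚ./ 1) ℚ.* (ℤ.+ 1 ℚ./ n) ≡ 1ℚ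
  n*1/n≡1 = ℚₚ.toℚᵘ-injective (begin
    ℚ.toℚᵘ ((ℤ.+ n ℚ./ 1) ℚ.* (ℤ.+ 1 ℚ./ n))
      ≈⟨ ℚₚ.toℚᵘ-homo-* (ℤ.+ n ℚ./ 1) (ℤ.+ 1 ℚ./ n) ⟩
    ℚ.toℚᵘ (ℤ.+ n ℚ./ 1) ℚᵘ.* ℚ.toℚᵘ (ℤ.+ 1 ℚ./ n)
      ≈⟨ ℚᵘₚ.*-cong (ℚₚ.toℚᵘ-fromℚᵘ (ℚᵘ.mkℚᵘ (ℤ.+ n) 0))
                    (ℚₚ.toℚᵘ-fromℚᵘ (ℚᵘ.mkℚᵘ (ℤ.+ 1) k)) ⟩
    ℚᵘ.mkℚᵘ (ℤ.+ n) 0 ℚᵘ.* ℚᵘ.mkℚᵘ (ℤ.+ 1) k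
      ≈⟨ ℚᵘₚ.*-inverseʳ (ℚᵘ.mkℚᵘ (ℤ.+ n) 0) ⟩
    ℚᵘ.1ℚᵘ ∎)
    where open ℚᵘₚ.≃-Reasoning

-- z (z − 1) ⋯ (z − j + 1)
falling : ℂ → ℕ → ℂ
falling z zero    = 1#
falling z (suc j) = falling z j * (z - fromℕ j)

binom : ℂ → ℕ → ℂ
binom z j = 1/ℕ (j !) {{j ℕₚ.!≢0}} * falling z j

open import Algebra.Properties.Monoid.Sum (CommutativeRing.+-monoid ℂ-commutativeRing)
  using (sum)

sum₁ : ℕ → (ℕ → ℂ) → ℂ
sum₁ n f = sum {n} λ i → f (suc (toℕ i))

infixl 10 sum₁
syntax sum₁ n (λ m → x) = ∑[1≤ m ≤ n ] x

{-# OPTIONS --safe #-}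
module Submission where

-- Write B z n = z choose n and * for convolution in n. Absorption,
-- (n+1) B z (n+1) = z B (z−1) n, says that B z has derivative z B (z−1), so the
-- Leibniz rule gives Vandermonde B x * B y = B (x+y) by induction on n.
-- The product of the two triangular matrices has (n, m) entry, up to the factor
-- 1/n, the coefficient at N = n − m of ((m+j) B (mt) j)ⱼ * B (−nt). For N ≥ 1 it
-- equals m B (−Nt) N + mt B (−Nt−1) (N−1), which vanishes by absorption.

open import Algebra.Bundles using (CommutativeRing)
open import Data.Fin.Base using (toℕ)
import Data.Integer.Base as ℤ
import Data.Integer.Properties as ℤₚ
open import Data.Nat.Base as ℕ
  using (ℕ; zero; suc; NonZero; _∸_; _<_; _≤_; z<s; s<s; _!)
open import Data.Nat.Induction using (<-rec)
import Data.Nat.Properties as ℕₚ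
import Data.Rational.Base as ℚ
import Data.Rational.Properties as ℚₚ
import Data.Rational.Unnormalised.Base as ℚᵘ
import Data.Rational.Unnormalised.Properties as ℚᵘₚ
open import Function.Base using (_∘_)
open import Function.Bundles using (_⇔_; mk⇔; module Equivalence)
open import Level using (Level)
open import Relation.Binary.PropositionalEquality as ≡ using (_≡_)

-- Division in `ℚ` normalises by a gcd that does not reduce for a variable `n`. The equation is
-- therefore moved to unnormalised rationals, where it is an identity of integers.
suc/1 : ∀ n → ℤ.+ suc n ℚ./ 1 ≡ ℚ.1ℚ ℚ.+ (ℤ.+ n ℚ./ 1)
suc/1 n = ℚₚ.toℚᵘ-injective (begin
  ℚ.toℚᵘ (ℤ.+ suc n ℚ./ 1)
    ≈⟨ ℚₚ.toℚᵘ-fromℚᵘ (ι (suc n)) ⟩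
  ι (suc n)
    ≈⟨ ℚᵘ.*≡* (≡.cong (λ k → (ℤ.1ℤ ℤ.+ k) ℤ.* ℤ.1ℤ) (≡.sym (ℤₚ.*-identityʳ (ℤ.+ n)))) ⟩
  ℚᵘ.1ℚᵘ ℚᵘ.+ ι n
    ≈⟨ ℚᵘₚ.+-congʳ ℚᵘ.1ℚᵘ (ℚₚ.toℚᵘ-fromℚᵘ (ι n)) ⟨
  ℚᵘ.1ℚᵘ ℚᵘ.+ ℚ.toℚᵘ (ℤ.+ n ℚ./ 1)
    ≈⟨ ℚₚ.toℚᵘ-homo-+ ℚ.1ℚ (ℤ.+ n ℚ./ 1) ⟨
  ℚ.toℚᵘ (ℚ.1ℚ ℚ.+ (ℤ.+ n ℚ./ 1))
    ∎)
  where
  open ℚᵘₚ.≃-Reasoning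
  ι : ℕ → ℚᵘ.ℚᵘ
  ι m = ℚᵘ.mkℚᵘ (ℤ.+ m) 0

-- Finite and triangular sums in a commutative ring.

module TriangularSums {c ℓ : Level} (R : CommutativeRing c ℓ) where

  open CommutativeRing R
  open import Algebra.Properties.Semiring.Sum semiring
    using (sum; ∑-distrib-+; *-distribˡ-sum; *-distribʳ-sum)
  open import Algebra.Properties.Semiring.Mult semiring
    using (_×_; ×-congʳ; ×-congˡ; ×-homo-+; ×-comm-*; ×-assoc-*)
  open import Algebra.Properties.CommutativeMonoid.Mult +-commutativeMonoid
    using (×-distrib-+)
  open import Algebra.Properties.Ring ring
    using (+-cancelˡ; +-inverseˡ-unique; -‿+-comm; -‿distribˡ-*)
  open import Algebra.Solver.Ring.NaturalCoefficients.Default commutativeSemiring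
    using (solve; con; _:=_; _:+_; _:*_)
  open import Relation.Binary.Reasoning.Setoid setoid

  ×-zero : ∀ k → k × 0# ≈ 0#
  ×-zero zero    = refl
  ×-zero (suc k) = trans (+-identityˡ _) (×-zero k)

  -- ∑ and conv are opaque so that their arguments can be inferred.
  opaque

    ∑ : ℕ → (ℕ → Carrier) → Carrier
    ∑ n f = sum {n} λ i → f (toℕ i)

    -- The bridge to the sums of the theorem, which are built from `sum`.
    ∑≡sum : ∀ n f → ∑ n f ≡ sum {n} (λ i → f (toℕ i))
    ∑≡sum n f = ≡.refl

    ∑-head : ∀ n f → ∑ (suc n) f ≈ f 0 + ∑ n (f ∘ suc)
    ∑-head n f = refl

    ∑-cong-< : ∀ n {f g : ℕ → Carrier} → (∀ i → i < n → f i ≈ g i) → ∑ n f ≈ ∑ n g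
    ∑-cong-< zero    f≈g = refl
    ∑-cong-< (suc n) f≈g =
      +-cong (f≈g 0 z<s) (∑-cong-< n λ i i<n → f≈g (suc i) (s<s i<n))

    ∑-0 : ∀ n {f : ℕ → Carrier} → (∀ i → i < n → f i ≈ 0#) → ∑ n f ≈ 0#
    ∑-0 zero    f≈0 = refl
    ∑-0 (suc n) f≈0 = trans
      (+-cong (f≈0 0 z<s) (∑-0 n λ i i<n → f≈0 (suc i) (s<s i<n)))
      (+-identityˡ 0#)

    ∑-last : ∀ n f → ∑ (suc n) f ≈ ∑ n f + f n
    ∑-last zero    f = +-comm (f 0) 0#
    ∑-last (suc n) f = trans (+-congˡ (∑-last n (f ∘ suc))) (sym (+-assoc _ _ _))

    ∑-+ : ∀ n f g → ∑ n (λ i → f i + g i) ≈ ∑ n f + ∑ n g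
    ∑-+ n f g = ∑-distrib-+ {n} (f ∘ toℕ) (g ∘ toℕ)

    *-∑ : ∀ n x f → x * ∑ n f ≈ ∑ n (λ i → x * f i)
    *-∑ n x f = *-distribˡ-sum {n} x (f ∘ toℕ)

    ∑-* : ∀ n x f → ∑ n f * x ≈ ∑ n (λ i → f i * x)
    ∑-* n x f = *-distribʳ-sum {n} x (f ∘ toℕ)

    ×-∑ : ∀ k n f → k × ∑ n f ≈ ∑ n (λ i → k × f i)
    ×-∑ k zero    f = ×-zero k
    ×-∑ k (suc n) f = trans (×-distrib-+ _ _ k) (+-congˡ (×-∑ k n (f ∘ suc)))

    -- Both sides run over 0 ≤ m ≤ k < n, first by rows `k`, then by columns `m` with k = m + j. The
    -- induction removes the column m = 0; what is left is a smaller triangle with both indices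
    -- shifted.
    ∑-triangle : ∀ n (F : ℕ → ℕ → Carrier) →
      ∑ n (λ k → ∑ (suc k) (F k)) ≈ ∑ n (λ m → ∑ (n ∸ m) λ j → F (m ℕ.+ j) m)
    ∑-triangle zero    F = refl
    ∑-triangle (suc n) F = begin
      ∑ (suc n) (λ k → F k 0 + ∑ k (F k ∘ suc))
        ≈⟨ ∑-+ (suc n) (λ k → F k 0) (λ k → ∑ k (F k ∘ suc)) ⟩
      -- The `0#` is row 0, which is empty once its only entry, in column 0, is gone.
      ∑ (suc n) (λ k → F k 0) + (0# + ∑ n (λ k → ∑ (suc k) (F (suc k) ∘ suc)))
        ≈⟨ +-congˡ (+-identityˡ _) ⟩
      ∑ (suc n) (λ k → F k 0) + ∑ n (λ k → ∑ (suc k) (F (suc k) ∘ suc))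
        ≈⟨ +-congˡ (∑-triangle n λ k m → F (suc k) (suc m)) ⟩
      ∑ (suc n) (λ m → ∑ (suc n ∸ m) λ j → F (m ℕ.+ j) m)
        ∎

  ∑-cong : ∀ n {f g : ℕ → Carrier} → (∀ i → f i ≈ g i) → ∑ n f ≈ ∑ n g
  ∑-cong n f≈g = ∑-cong-< n λ i _ → f≈g i

  -- Forward substitution: by strong induction the terms with k < n agree and cancel, which leaves
  -- the diagonal term.
  unitriangular-injective : (C : ℕ → ℕ → Carrier) → (∀ n → C n n ≈ 1#) →
    ∀ {a a′ : ℕ → Carrier} →
    (∀ n → ∑ (suc n) (λ k → C n k * a k) ≈ ∑ (suc n) (λ k → C n k * a′ k)) →
    ∀ n → a n ≈ a′ n
  unitriangular-injective C Cnn≈1 {a} {a′} eq = <-rec (λ n → a n ≈ a′ n) λ n ih → begin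
    a n          ≈⟨ *-identityˡ _ ⟨
    1# * a n     ≈⟨ *-congʳ (Cnn≈1 n) ⟨
    C n n * a n  ≈⟨ +-cancelˡ (∑ n λ k → C n k * a k) _ _ (begin
      ∑ n (λ k → C n k * a k) + C n n * a n    ≈⟨ ∑-last n (λ k → C n k * a k) ⟨
      ∑ (suc n) (λ k → C n k * a k)            ≈⟨ eq n ⟩
      ∑ (suc n) (λ k → C n k * a′ k)           ≈⟨ ∑-last n (λ k → C n k * a′ k) ⟩
      ∑ n (λ k → C n k * a′ k) + C n n * a′ n
        ≈⟨ +-congʳ (∑-cong-< n λ k k<n → *-congˡ (ih k<n)) ⟨
      ∑ n (λ k → C n k * a k) + C n n * a′ n   ∎) ⟩
    C n n * a′ n  ≈⟨ *-congʳ (Cnn≈1 n) ⟩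
    1# * a′ n     ≈⟨ *-identityˡ _ ⟩
    a′ n          ∎

  -- Convolution and the formal derivative.

  opaque

    conv : (f g : ℕ → Carrier) → ℕ → Carrier
    conv f g n = ∑ (suc n) λ j → f j * g (n ∸ j)

    conv≡∑ : ∀ f g n → conv f g n ≡ ∑ (suc n) (λ j → f j * g (n ∸ j))
    conv≡∑ f g n = ≡.refl

    conv-0 : ∀ f g → conv f g 0 ≈ f 0 * g 0
    conv-0 f g = trans (∑-last 0 _) (trans (+-congʳ (∑-0 0 λ _ ())) (+-identityˡ _))

    conv-suc : ∀ f g n → conv f g (suc n) ≈ f 0 * g (suc n) + conv (f ∘ suc) g n
    conv-suc f g n = ∑-head (suc n) λ j → f j * g (suc n ∸ j)

    conv-cong : ∀ {f f′ g g′ : ℕ → Carrier} → (∀ n → f n ≈ f′ n) → (∀ n → g n ≈ g′ n) →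
      ∀ n → conv f g n ≈ conv f′ g′ n
    conv-cong f≈f′ g≈g′ n = ∑-cong (suc n) λ j → *-cong (f≈f′ j) (g≈g′ (n ∸ j))

    conv-+ˡ : ∀ f f′ g n → conv (λ j → f j + f′ j) g n ≈ conv f g n + conv f′ g n
    conv-+ˡ f f′ g n = trans (∑-cong (suc n) λ j → distribʳ _ _ _)
      (∑-+ (suc n) (λ j → f j * g (n ∸ j)) (λ j → f′ j * g (n ∸ j)))

    conv-*ˡ : ∀ x f g n → conv (λ j → x * f j) g n ≈ x * conv f g n
    conv-*ˡ x f g n = trans (∑-cong (suc n) λ j → *-assoc _ _ _)
      (sym (*-∑ (suc n) x λ j → f j * g (n ∸ j)))

    conv-*ʳ : ∀ x f g n → conv f (λ j → x * g j) n ≈ x * conv f g n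
    conv-*ʳ x f g n = trans
      (∑-cong (suc n) λ j →
        solve 3 (λ f x g → f :* (x :* g) := x :* (f :* g)) refl (f j) x (g (n ∸ j)))
      (sym (*-∑ (suc n) x λ j → f j * g (n ∸ j)))

    conv-×ˡ : ∀ k f g n → conv (λ j → k × f j) g n ≈ k × conv f g n
    conv-×ˡ k f g n = trans (∑-cong (suc n) λ j → ×-assoc-* k _ _)
      (sym (×-∑ k (suc n) λ j → f j * g (n ∸ j)))

  -- The coefficients of the derivative of the power series ∑ f n xⁿ.
  ∂ : (ℕ → Carrier) → ℕ → Carrier
  ∂ f n = suc n × f (suc n)

  -- The Leibniz rule. The induction on `n` keeps `f` general, since `conv-suc` splits off `f 0` and
  -- leaves a convolution with the shifted sequence `f ∘ suc`.
  ∂-conv : ∀ f g n → ∂ (conv f g) n ≈ conv (∂ f) g n + conv f (∂ g) n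
  ∂-conv f g zero = begin
    conv f g 1 + 0#
      ≈⟨ +-congʳ (trans (conv-suc f g 0) (+-congˡ (conv-0 (f ∘ suc) g))) ⟩
    f 0 * g 1 + f 1 * g 0 + 0#
      ≈⟨ solve 4 (λ f₀ f₁ g₀ g₁ →
           f₀ :* g₁ :+ f₁ :* g₀ :+ con 0 := (f₁ :+ con 0) :* g₀ :+ f₀ :* (g₁ :+ con 0))
           refl (f 0) (f 1) (g 0) (g 1) ⟩
    (f 1 + 0#) * g 0 + f 0 * (g 1 + 0#)
      ≈⟨ +-cong (conv-0 (∂ f) g) (conv-0 f (∂ g)) ⟨
    conv (∂ f) g 0 + conv f (∂ g) 0
      ∎
  ∂-conv f g (suc n) = begin
    N × conv f g N
      ≈⟨ ×-congʳ N (conv-suc f g (suc n)) ⟩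
    N × (f 0 * g N + conv f′ g (suc n))
      ≈⟨ ×-distrib-+ _ _ N ⟩
    N × (f 0 * g N) + (conv f′ g (suc n) + suc n × conv f′ g (suc n))
      -- Of the `N` copies of the tail, one is expanded by `conv-suc`; the other `suc n` form
      -- `∂ (conv f′ g) n`, to which the induction hypothesis applies.
      ≈⟨ +-cong (sym (×-comm-* N _ _)) (+-cong (conv-suc f′ g n) (∂-conv f′ g n)) ⟩
    f 0 * ∂ g (suc n) + ((f 1 * g (suc n) + conv (f′ ∘ suc) g n)
      + (conv (∂ f′) g n + conv f′ (∂ g) n))
      ≈⟨ solve 5 (λ a b c d e →
           a :+ ((b :+ c) :+ (d :+ e)) := (b :+ (c :+ d)) :+ (a :+ e)) refl
           (f 0 * ∂ g (suc n)) (f 1 * g (suc n)) (conv (f′ ∘ suc) g n)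
           (conv (∂ f′) g n) (conv f′ (∂ g) n) ⟩
    (f 1 * g (suc n) + (conv (f′ ∘ suc) g n + conv (∂ f′) g n))
      + (f 0 * ∂ g (suc n) + conv f′ (∂ g) n)
      -- By definition `∂ f (suc j)` is `f′ (suc j) + ∂ f′ j`, so the two convolutions merge.
      ≈⟨ +-congʳ (+-cong (*-congʳ (+-identityʳ (f 1))) (conv-+ˡ (f′ ∘ suc) (∂ f′) g n)) ⟨
    (∂ f 0 * g (suc n) + conv (∂ f ∘ suc) g n) + (f 0 * ∂ g (suc n) + conv f′ (∂ g) n)
      ≈⟨ +-cong (conv-suc (∂ f) g n) (conv-suc f (∂ g) n) ⟨
    conv (∂ f) g (suc n) + conv f (∂ g) (suc n)
      ∎
    where
    N  = suc (suc n)
    f′ = f ∘ suc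

  -- Binomial inversion from absorption.

  module BinomialInversion
    (×-cancel : ∀ n {x y} → suc n × x ≈ suc n × y → x ≈ y)
    (B : Carrier → ℕ → Carrier)
    (B-cong : ∀ {x y} → x ≈ y → ∀ n → B x n ≈ B y n)
    (B-zero : ∀ z → B z 0 ≈ 1#)
    -- Absorption. Together with `B-zero` and `×-cancel` it fixes every `B z n` by induction on `n`.
    (∂-B : ∀ z n → ∂ (B z) n ≈ z * B (z - 1#) n)
    where

    -- Both sides are 1 at n = 0, and by absorption their derivatives satisfy
    -- the same recurrence.
    vandermonde : ∀ x y n → conv (B x) (B y) n ≈ B (x + y) n
    vandermonde x y zero = begin
      conv (B x) (B y) 0  ≈⟨ conv-0 (B x) (B y) ⟩
      B x 0 * B y 0       ≈⟨ *-cong (B-zero x) (B-zero y) ⟩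
      1# * 1#             ≈⟨ *-identityˡ _ ⟩
      1#                  ≈⟨ B-zero (x + y) ⟨
      B (x + y) 0         ∎
    vandermonde x y (suc n) = ×-cancel n (begin
      ∂ (conv (B x) (B y)) n
        ≈⟨ ∂-conv (B x) (B y) n ⟩
      conv (∂ (B x)) (B y) n + conv (B x) (∂ (B y)) n
        ≈⟨ +-cong (conv-cong (∂-B x) (λ _ → refl) n) (conv-cong (λ _ → refl) (∂-B y) n) ⟩
      conv (λ j → x * B (x - 1#) j) (B y) n + conv (B x) (λ j → y * B (y - 1#) j) n
        ≈⟨ +-cong (conv-*ˡ x (B (x - 1#)) (B y) n) (conv-*ʳ y (B x) (B (y - 1#)) n) ⟩
      x * conv (B (x - 1#)) (B y) n + y * conv (B x) (B (y - 1#)) n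
        ≈⟨ +-cong (*-congˡ (vandermonde (x - 1#) y n)) (*-congˡ (vandermonde x (y - 1#) n)) ⟩
      x * B (x - 1# + y) n + y * B (x + (y - 1#)) n
        ≈⟨ +-cong
             (*-congˡ (B-cong (solve 3 (λ x y ν → (x :+ ν) :+ y := (x :+ y) :+ ν) refl x y (- 1#)) n))
             (*-congˡ (B-cong (sym (+-assoc x y (- 1#))) n)) ⟩
      x * B (x + y - 1#) n + y * B (x + y - 1#) n
        ≈⟨ distribʳ _ x y ⟨
      (x + y) * B (x + y - 1#) n
        ≈⟨ ∂-B (x + y) n ⟨
      ∂ (B (x + y)) n
        ∎)

    -- This is the vanishing of the off-diagonal entries. The weight m + j is split: the part `m` is
    -- plain Vandermonde, and the part `j` turns `B x` into its derivative, so that absorption and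
    -- Vandermonde apply one degree lower. The two results are opposite.
    orthogonality : ∀ t m N {x y} → x ≈ m × t → x + y ≈ - (suc N × t) →
      conv (λ j → (m ℕ.+ j) × B x j) (B y) (suc N) ≈ 0#
    orthogonality t m N {x} {y} x≈mt x+y≈w = begin
      conv (λ j → (m ℕ.+ j) × B x j) (B y) (suc N)
        ≈⟨ conv-cong (λ j → ×-homo-+ (B x j) m j) (λ _ → refl) (suc N) ⟩
      conv (λ j → m × B x j + j × B x j) (B y) (suc N)
        ≈⟨ conv-+ˡ (λ j → m × B x j) (λ j → j × B x j) (B y) (suc N) ⟩
      conv (λ j → m × B x j) (B y) (suc N) + conv (λ j → j × B x j) (B y) (suc N)
        -- The term j = 0 vanishes, and `j × B x j` shifted by one is `∂ (B x)` by definition. Hence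
        -- the index drops from `suc N` to `N`.
        ≈⟨ +-cong (conv-×ˡ m (B x) (B y) (suc N)) (trans (conv-suc (λ j → j × B x j) (B y) N)
             (trans (+-congʳ (zeroˡ _)) (+-identityˡ _))) ⟩
      m × conv (B x) (B y) (suc N) + conv (∂ (B x)) (B y) N
        ≈⟨ +-cong (×-congʳ m (trans (vandermonde x y (suc N)) (B-cong x+y≈w (suc N)))) shifted ⟩
      m × B w (suc N) + m × (t * β)
        ≈⟨ ×-distrib-+ _ _ m ⟨
      m × (B w (suc N) + t * β)
        ≈⟨ ×-congʳ m (+-congʳ Bw≈-tβ) ⟩
      m × (- (t * β) + t * β)
        ≈⟨ ×-congʳ m (-‿inverseˡ _) ⟩
      m × 0#
        ≈⟨ ×-zero m ⟩
      0#
        ∎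
      where
      w = - (suc N × t)
      β = B (w - 1#) N

      shifted : conv (∂ (B x)) (B y) N ≈ m × (t * β)
      shifted = begin
        conv (∂ (B x)) (B y) N
          ≈⟨ conv-cong (∂-B x) (λ _ → refl) N ⟩
        conv (λ j → x * B (x - 1#) j) (B y) N
          ≈⟨ conv-*ˡ x (B (x - 1#)) (B y) N ⟩
        x * conv (B (x - 1#)) (B y) N
          ≈⟨ *-cong x≈mt (vandermonde (x - 1#) y N) ⟩
        m × t * B (x - 1# + y) N
          ≈⟨ *-congˡ (B-cong (trans
               (solve 3 (λ x y ν → (x :+ ν) :+ y := (x :+ y) :+ ν) refl x y (- 1#))
               (+-congʳ x+y≈w)) N) ⟩
        m × t * β
          ≈⟨ ×-assoc-* m t β ⟩
        m × (t * β)
          ∎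

      -- Absorption at `w` gives `w * β`, and `w` carries the same factor `suc N` as the left side,
      -- so that factor cancels.
      Bw≈-tβ : B w (suc N) ≈ - (t * β)
      Bw≈-tβ = ×-cancel N (begin
        suc N × B w (suc N)      ≈⟨ ∂-B w N ⟩
        - (suc N × t) * β        ≈⟨ -‿distribˡ-* (suc N × t) β ⟨
        - (suc N × t * β)        ≈⟨ -‿cong (×-assoc-* (suc N) t β) ⟩
        - (suc N × (t * β))      ≈⟨ +-inverseˡ-unique _ _ (begin
          suc N × (- (t * β)) + suc N × (t * β)  ≈⟨ ×-distrib-+ _ _ (suc N) ⟨
          suc N × (- (t * β) + t * β)            ≈⟨ ×-congʳ (suc N) (-‿inverseˡ _) ⟩
          suc N × 0#                             ≈⟨ ×-zero (suc N) ⟩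
          0#                                     ∎) ⟨
        suc N × (- (t * β))      ∎)

    -- The first formula is substituted into the second and the sums are exchanged; then only the
    -- diagonal survives. Index `m` stands for m + 1 in the theorem, a shift that does not change
    -- the differences `n ∸ k` and `k ∸ m`.
    left-inverse : ∀ t (b : ℕ → Carrier) n →
      ∑ (suc n) (λ k → B (- (suc n × t)) (n ∸ k) *
        (suc k × ∑ (suc k) (λ m → B (suc m × t) (k ∸ m) * b m)))
      ≈ suc n × b n
    left-inverse t b n = begin
      ∑ (suc n) (λ k → B y (n ∸ k) * (suc k × ∑ (suc k) (λ m → B (x m) (k ∸ m) * b m)))
        ≈⟨ ∑-cong (suc n) (λ k → trans
             (*-congˡ (×-∑ (suc k) (suc k) λ m → B (x m) (k ∸ m) * b m))
             (*-∑ (suc k) (B y (n ∸ k)) λ m → suc k × (B (x m) (k ∸ m) * b m))) ⟩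
      ∑ (suc n) (λ k → ∑ (suc k) (F k))
        ≈⟨ ∑-triangle (suc n) F ⟩
      ∑ (suc n) (λ m → ∑ (suc n ∸ m) λ j → F (m ℕ.+ j) m)
        ≈⟨ ∑-cong-< (suc n) (λ m m<1+n → inner m (ℕₚ.≤-pred m<1+n)) ⟩
      ∑ (suc n) (λ m → D m (n ∸ m) * b m)
        ≈⟨ ∑-last n (λ m → D m (n ∸ m) * b m) ⟩
      ∑ n (λ m → D m (n ∸ m) * b m) + D n (n ∸ n) * b n
        ≈⟨ +-cong (∑-0 n λ m m<n → trans (*-congʳ (off-diagonal m m<n)) (zeroˡ (b m)))
             (*-congʳ (trans (reflexive (≡.cong (D n) (ℕₚ.n∸n≡0 n))) diagonal)) ⟩
      0# + suc n × 1# * b n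
        ≈⟨ +-identityˡ _ ⟩
      suc n × 1# * b n
        ≈⟨ ×-assoc-* (suc n) 1# (b n) ⟩
      suc n × (1# * b n)
        ≈⟨ ×-congʳ (suc n) (*-identityˡ (b n)) ⟩
      suc n × b n
        ∎
      where
      y = - (suc n × t)
      x : ℕ → Carrier
      x m = suc m × t
      -- `F k m` is the term of the double sum in row `k` and column `m`. `D m (n ∸ m)` is the entry
      -- (n, m) of the product of the two matrices, before division by `suc n`.
      F D : ℕ → ℕ → Carrier
      F k m = B y (n ∸ k) * (suc k × (B (x m) (k ∸ m) * b m))
      D m = conv (λ j → (suc m ℕ.+ j) × B (x m) j) (B y)

      inner : ∀ m → m ≤ n → ∑ (suc n ∸ m) (λ j → F (m ℕ.+ j) m) ≈ D m (n ∸ m) * b m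
      inner m m≤n = begin
        ∑ (suc n ∸ m) (λ j → F (m ℕ.+ j) m)
          -- Here m ≤ n is needed: it makes the number of terms `suc (n ∸ m)`, as in a convolution
          -- at `n ∸ m`.
          ≡⟨ ≡.cong (λ l → ∑ l λ j → F (m ℕ.+ j) m) (ℕₚ.+-∸-assoc 1 m≤n) ⟩
        ∑ (suc (n ∸ m)) (λ j → F (m ℕ.+ j) m)
          ≈⟨ ∑-cong (suc (n ∸ m)) (λ j → begin
               B y (n ∸ (m ℕ.+ j)) * (suc (m ℕ.+ j) × (B (x m) (m ℕ.+ j ∸ m) * b m))
                 ≡⟨ ≡.cong₂ (λ p q → B y p * (suc (m ℕ.+ j) × (B (x m) q * b m)))
                      (≡.sym (ℕₚ.∸-+-assoc n m j)) (ℕₚ.m+n∸m≡n m j) ⟩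
               B y (n ∸ m ∸ j) * (suc (m ℕ.+ j) × (B (x m) j * b m))
                 ≈⟨ *-congˡ (×-assoc-* (suc (m ℕ.+ j)) _ _) ⟨
               B y (n ∸ m ∸ j) * (suc (m ℕ.+ j) × B (x m) j * b m)
                 ≈⟨ solve 3 (λ p q r → p :* (q :* r) := q :* p :* r) refl _ _ _ ⟩
               suc (m ℕ.+ j) × B (x m) j * B y (n ∸ m ∸ j) * b m
                 ∎) ⟩
        ∑ (suc (n ∸ m)) (λ j → (suc m ℕ.+ j) × B (x m) j * B y (n ∸ m ∸ j) * b m)
          ≈⟨ ∑-* (suc (n ∸ m)) (b m) (λ j → (suc m ℕ.+ j) × B (x m) j * B y (n ∸ m ∸ j)) ⟨
        ∑ (suc (n ∸ m)) (λ j → (suc m ℕ.+ j) × B (x m) j * B y (n ∸ m ∸ j)) * b m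
          ≡⟨ ≡.cong (_* b m) (conv≡∑ (λ j → (suc m ℕ.+ j) × B (x m) j) (B y) (n ∸ m)) ⟨
        D m (n ∸ m) * b m
          ∎

      diagonal : D n 0 ≈ suc n × 1#
      diagonal = begin
        D n 0
          ≈⟨ conv-0 (λ j → (suc n ℕ.+ j) × B (x n) j) (B y) ⟩
        (suc n ℕ.+ 0) × B (x n) 0 * B y 0
          ≈⟨ *-cong (trans (×-congˡ (ℕₚ.+-identityʳ (suc n))) (×-congʳ (suc n) (B-zero (x n))))
               (B-zero y) ⟩
        suc n × 1# * 1#
          ≈⟨ *-identityʳ _ ⟩
        suc n × 1#
          ∎

      -- With N = n ∸ suc m, the index `n ∸ m` becomes `suc N`. Then suc n = suc m + suc N, so the
      -- upper arguments `x m` and `y` add up to the negative multiple of `t` that `orthogonality`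
      -- asks for.
      off-diagonal : ∀ m → m < n → D m (n ∸ m) ≈ 0#
      off-diagonal m m<n = trans
        (reflexive (≡.cong (D m) (ℕₚ.+-∸-assoc 1 m<n)))
        (orthogonality t (suc m) N refl (begin
          x m + - (suc n × t)
            ≈⟨ +-congˡ (-‿cong (×-congˡ (≡.cong suc
                 (≡.sym (≡.trans (ℕₚ.+-suc m N) (ℕₚ.m+[n∸m]≡n m<n)))))) ⟩
          x m + - ((suc m ℕ.+ suc N) × t)
            ≈⟨ +-congˡ (-‿cong (×-homo-+ t (suc m) (suc N))) ⟩
          x m + - (x m + suc N × t)
            ≈⟨ +-congˡ (-‿+-comm _ _) ⟨
          x m + (- x m + - (suc N × t))
            ≈⟨ +-assoc _ _ _ ⟨
          x m + - x m + - (suc N × t)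
            ≈⟨ +-congʳ (-‿inverseʳ (x m)) ⟩
          0# + - (suc N × t)
            ≈⟨ +-identityˡ _ ⟩
          - (suc N × t)
            ∎))
        where N = n ∸ suc m

    -- A triangular matrix with unit diagonal is injective, so its right inverse
    -- is also a left inverse.
    inversion : ∀ t (a b : ℕ → Carrier) →
      (∀ n → a n ≈ suc n × ∑ (suc n) (λ m → B (suc m × t) (n ∸ m) * b m))
      ⇔
      (∀ n → suc n × b n ≈ ∑ (suc n) (λ m → B (- (suc n × t)) (n ∸ m) * a m))
    inversion t a b = mk⇔
      (λ a≈ n → trans (sym (left-inverse t b n))
        (∑-cong (suc n) λ k → *-congˡ (sym (a≈ k))))
      (λ b≈ → unitriangular-injective
        (λ n k → B (- (suc n × t)) (n ∸ k))
        (λ n → trans (reflexive (≡.cong (B _) (ℕₚ.n∸n≡0 n))) (B-zero _))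
        λ n → trans (sym (b≈ n)) (sym (left-inverse t b n)))

-- Natural multiples and inverse factorials in the complex numbers.

open import Defs

open CommutativeRing ℂ-commutativeRing
  using ( refl; sym; trans; reflexive; setoid; ring; semiring; commutativeSemiring
        ; +-cong; +-congˡ; +-congʳ; +-identityʳ; *-cong; *-congˡ; *-congʳ; *-comm
        ; *-assoc; *-identityˡ; *-identityʳ; zeroˡ; distribʳ; -‿cong)
open import Algebra.Properties.Ring ring using (-‿+-comm; -0#≈0#)
open import Algebra.Properties.Semiring.Mult semiring using (_×_; ×-congʳ; ×1-homo-*)
open import Algebra.Solver.Ring.NaturalCoefficients.Default commutativeSemiring
  using (solve; _:=_; _:+_; _:*_)
open import Relation.Binary.Reasoning.Setoid setoid

fromℕ-suc : ∀ n → fromℕ (suc n) ≈ 1# + fromℕ n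
fromℕ-suc n = trans (reflexive (≡.cong fromℚ (suc/1 n))) (fromℚ-homo-+ ℚ.1ℚ (ℤ.+ n ℚ./ 1))

-- Links the products by `fromℕ n` in the theorem with the iterated addition used over a general
-- ring.
fromℕ-* : ∀ n x → fromℕ n * x ≈ n × x
fromℕ-* zero    x = zeroˡ x
fromℕ-* (suc n) x = begin
  fromℕ (suc n) * x       ≈⟨ *-congʳ (fromℕ-suc n) ⟩
  (1# + fromℕ n) * x      ≈⟨ distribʳ x 1# (fromℕ n) ⟩
  1# * x + fromℕ n * x    ≈⟨ +-cong (*-identityˡ x) (fromℕ-* n x) ⟩
  x + n × x               ∎

fromℕ≈×1 : ∀ n → fromℕ n ≈ n × 1#
fromℕ≈×1 n = trans (sym (*-identityʳ (fromℕ n))) (fromℕ-* n 1#)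

fromℕ-homo-* : ∀ m n → fromℕ (m ℕ.* n) ≈ fromℕ m * fromℕ n
fromℕ-homo-* m n = begin
  fromℕ (m ℕ.* n)      ≈⟨ fromℕ≈×1 (m ℕ.* n) ⟩
  (m ℕ.* n) × 1#       ≈⟨ ×1-homo-* m n ⟩
  m × 1# * n × 1#      ≈⟨ *-cong (fromℕ≈×1 m) (fromℕ≈×1 n) ⟨
  fromℕ m * fromℕ n    ∎

1/ℕ-× : ∀ n x → 1/ℕ (suc n) * (suc n × x) ≈ x
1/ℕ-× n x = begin
  1/ℕ (suc n) * (suc n × x)              ≈⟨ *-congˡ (fromℕ-* (suc n) x) ⟨
  1/ℕ (suc n) * (fromℕ (suc n) * x)      ≈⟨ *-assoc _ _ x ⟨
  1/ℕ (suc n) * fromℕ (suc n) * x        ≈⟨ *-congʳ (*-comm _ _) ⟩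
  fromℕ (suc n) * 1/ℕ (suc n) * x        ≈⟨ *-congʳ (1/ℕ-inverseʳ (suc n)) ⟩
  1# * x                                 ≈⟨ *-identityˡ x ⟩
  x                                      ∎

×-1/ℕ : ∀ n x → suc n × (1/ℕ (suc n) * x) ≈ x
×-1/ℕ n x = begin
  suc n × (1/ℕ (suc n) * x)          ≈⟨ fromℕ-* (suc n) _ ⟨
  fromℕ (suc n) * (1/ℕ (suc n) * x)  ≈⟨ *-assoc _ _ x ⟨
  fromℕ (suc n) * 1/ℕ (suc n) * x    ≈⟨ *-congʳ (1/ℕ-inverseʳ (suc n)) ⟩
  1# * x                             ≈⟨ *-identityˡ x ⟩
  x                                  ∎

×-cancel : ∀ n {x y} → suc n × x ≈ suc n × y → x ≈ y
×-cancel n {x} {y} eq = trans (sym (1/ℕ-× n x)) (trans (*-congˡ eq) (1/ℕ-× n y))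

1/! : ℕ → ℂ
1/! n = 1/ℕ (n !) {{n ℕₚ.!≢0}}

fromℕ-1/! : ∀ n → fromℕ (n !) * 1/! n ≈ 1#
fromℕ-1/! n = 1/ℕ-inverseʳ (n !) {{n ℕₚ.!≢0}}

-- Multiplying by 1 = n! (1/n!) makes (n+1) n! = (n+1)! appear, which cancels against its own
-- inverse.
fromℕ-*-1/!-suc : ∀ n → fromℕ (suc n) * 1/! (suc n) ≈ 1/! n
fromℕ-*-1/!-suc n = begin
  p * u                       ≈⟨ *-identityʳ _ ⟨
  p * u * 1#                  ≈⟨ *-congˡ (fromℕ-1/! n) ⟨
  p * u * (q * v)             ≈⟨ solve 4 (λ p u q v → p :* u :* (q :* v) := p :* q :* u :* v) refl p u q v ⟩
  p * q * u * v               ≈⟨ *-congʳ (*-congʳ (fromℕ-homo-* (suc n) (n !))) ⟨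
  fromℕ (suc n !) * u * v     ≈⟨ *-congʳ (fromℕ-1/! (suc n)) ⟩
  1# * v                      ≈⟨ *-identityˡ v ⟩
  v                           ∎
  where
  p = fromℕ (suc n)
  q = fromℕ (n !)
  u = 1/! (suc n)
  v = 1/! n

-- Falling factorials and absorption for binomial coefficients.

falling-cong : ∀ {x y} → x ≈ y → ∀ n → falling x n ≈ falling y n
falling-cong x≈y zero    = refl
falling-cong x≈y (suc n) = *-cong (falling-cong x≈y n) (+-congʳ x≈y)

-- The definition splits off the last factor, but absorption needs the first one. The induction step
-- is z - (n+1) = (z - 1) - n.
falling-suc : ∀ z n → falling z (suc n) ≈ z * falling (z - 1#) n
falling-suc z zero = begin
  1# * (z - fromℕ 0)  ≈⟨ *-identityˡ _ ⟩
  z - 0#              ≈⟨ +-congˡ -0#≈0# ⟩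
  z + 0#              ≈⟨ +-identityʳ z ⟩
  z                   ≈⟨ *-identityʳ z ⟨
  z * 1#              ∎
falling-suc z (suc n) = begin
  falling z (suc n) * (z - fromℕ (suc n))
    ≈⟨ *-cong (falling-suc z n) (+-congˡ (trans (-‿cong (fromℕ-suc n)) (sym (-‿+-comm 1# (fromℕ n))))) ⟩
  z * f * (z + (- 1# + - fromℕ n))
    ≈⟨ solve 4 (λ z f ν μ → z :* f :* (z :+ (ν :+ μ)) := z :* (f :* ((z :+ ν) :+ μ)))
         refl z f (- 1#) (- fromℕ n) ⟩
  z * (f * (z - 1# - fromℕ n))
    ∎
  where f = falling (z - 1#) n

binom-cong : ∀ {x y} → x ≈ y → ∀ n → binom x n ≈ binom y n
binom-cong x≈y n = *-congˡ (falling-cong x≈y n)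

binom-zero : ∀ z → binom z 0 ≈ 1#
binom-zero z = *-identityˡ 1#

-- The factor n+1 turns 1/(n+1)! into 1/n!, and `falling-suc` extracts `z`. This is the hypothesis
-- `∂-B` for `binom`.
binom-absorption : ∀ z n → suc n × binom z (suc n) ≈ z * binom (z - 1#) n
binom-absorption z n = begin
  suc n × (1/! (suc n) * falling z (suc n))
    ≈⟨ fromℕ-* (suc n) _ ⟨
  fromℕ (suc n) * (1/! (suc n) * falling z (suc n))
    ≈⟨ *-assoc _ _ _ ⟨
  fromℕ (suc n) * 1/! (suc n) * falling z (suc n)
    ≈⟨ *-cong (fromℕ-*-1/!-suc n) (falling-suc z n) ⟩
  1/! n * (z * falling (z - 1#) n)
    ≈⟨ solve 3 (λ v z f → v :* (z :* f) := z :* (v :* f)) refl (1/! n) z (falling (z - 1#) n) ⟩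
  z * binom (z - 1#) n
    ∎

-- Inversion for complex sequences indexed from 1.

open TriangularSums ℂ-commutativeRing using (∑; ∑≡sum; ∑-cong; module BinomialInversion)
open BinomialInversion ×-cancel binom binom-cong binom-zero binom-absorption using (inversion)

theorem3p3 : (t : ℂ) (a b : ℕ → ℂ) →
    (∀ n → .{{_ : NonZero n}} →
      a n ≈ fromℕ n * (∑[1≤ m ≤ n ] (binom (fromℕ m * t) (n ∸ m) * b m)))
    ⇔
    (∀ n → .{{_ : NonZero n}} →
      b n ≈ 1/ℕ n * (∑[1≤ m ≤ n ] (binom (- (fromℕ n * t)) (n ∸ m) * a m)))
theorem3p3 t a b = mk⇔
  (λ a≈ → λ { (suc n) → begin
    -- `inversion` has its second condition multiplied through by `suc n`; the factor is introduced
    -- here and divided out again.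
    b (suc n)                                ≈⟨ 1/ℕ-× n _ ⟨
    1/ℕ (suc n) * (suc n × b (suc n))        ≈⟨ *-congˡ (Equivalence.to a⇔b (λ k → trans (a≈ (suc k)) (A≈ k)) n) ⟩
    1/ℕ (suc n) * ∑ (suc n) (λ m → binom (- (suc n × t)) (n ∸ m) * a (suc m))
                                             ≈⟨ *-congˡ (B≈ n) ⟨
    1/ℕ (suc n) * (∑[1≤ m ≤ suc n ] (binom (- (fromℕ (suc n) * t)) (suc n ∸ m) * a m)) ∎ })
  (λ b≈ → λ { (suc n) → trans
    (Equivalence.from a⇔b (λ k → trans (×-congʳ (suc k) (b≈ (suc k))) (trans (×-1/ℕ k _) (B≈ k))) n)
    (sym (A≈ n)) })
  where
  -- The sequences of the theorem start at 1 and those of `inversion` at 0.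
  a⇔b = inversion t (a ∘ suc) (b ∘ suc)

  -- `A≈` and `B≈` carry the sums of the theorem to those of `inversion`. The shift from m to
  -- `suc m` costs nothing, as `suc n ∸ suc m` reduces to `n ∸ m`.
  A≈ : ∀ n → fromℕ (suc n) * (∑[1≤ m ≤ suc n ] (binom (fromℕ m * t) (suc n ∸ m) * b m)) ≈
    suc n × ∑ (suc n) (λ m → binom (suc m × t) (n ∸ m) * b (suc m))
  A≈ n = trans (fromℕ-* (suc n) _) (×-congʳ (suc n) (trans
    (reflexive (≡.sym (∑≡sum (suc n) λ m → binom (fromℕ (suc m) * t) (n ∸ m) * b (suc m))))
    (∑-cong (suc n) λ m → *-congʳ (binom-cong (fromℕ-* (suc m) t) (n ∸ m)))))

  B≈ : ∀ n → ∑[1≤ m ≤ suc n ] (binom (- (fromℕ (suc n) * t)) (suc n ∸ m) * a m) ≈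
    ∑ (suc n) (λ m → binom (- (suc n × t)) (n ∸ m) * a (suc m))
  B≈ n = trans
    (reflexive (≡.sym (∑≡sum (suc n) λ m → binom (- (fromℕ (suc n) * t)) (n ∸ m) * a (suc m))))
    (∑-cong (suc n) λ m → *-congʳ (binom-cong (-‿cong (fromℕ-* (suc n) t)) (n ∸ m)))
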